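{- For every $k\in\mathbb{N}$ and every $n\in\mathbb{N}$, \[ \mathrm{exm}(n,J_k) \le \frac{8}{3}(k+1)^2\cdot 2^{4k}\, n. \]
   Context: $J_k$ is the $k\times k$ matrix all of whose entries are $1$. An interval decomposition of the rows of a matrix is a partition of its rows into nonempty intervals of consecutive rows (similarly for columns). A block decomposition is given by an interval decomposition of rows into $t$ intervals and of columns into $t'$ intervals; the $(i,j)$-block is the submatrix on the $i$th row interval and the $j$th column interval. Contracting the blocks produces the $t\times t'$ binary matrix whose $(i,j)$ entry is $0$ iff the $(i,j)$-block is all zeros. A binary matrix $B$ is an interval minor of a binary matrix $A$ if $B$ can be obtained from $A$ by contracting the blocks of some block decomposition and then possibly replacing some $1$-entries by $0$-entries. $\mathrm{exm}(n,B)$ is the maximum number of $1$-entries in an $n\times n$ binary matrix that does not have $B$ as an interval minor. -}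

module Defs where

open import Data.Nat using (ℕ; zero; suc; _≤_; _<_)
open import Data.Bool using (Bool; true; false; if_then_else_; T)
open import Data.Fin using (Fin; toℕ; fromℕ; inject₁)
open import Data.List using (map; allFin)
open import Data.Nat.ListAction using (sum)
open import Data.Product using (Σ; ∃; _×_)
open import Relation.Binary.PropositionalEquality using (_≡_)
open import Relation.Nullary using (¬_)

Matrix : ℕ → ℕ → Set
Matrix m n = Fin m → Fin n → Bool

J : (k : ℕ) → Matrix k k
J k _ _ = true

-- An interval decomposition of {0,…,n-1} into t nonempty intervals of
-- consecutive elements, given by cut points
-- 0 = cut 0 < cut 1 < … < cut t = n ; interval i is [cut i, cut (i+1)).
record IntervalDecomp (n t : ℕ) : Set where
  field
    cut       : Fin (suc t) → ℕ
    cut-first : cut Fin.zero ≡ 0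
    cut-last  : cut (fromℕ t) ≡ n
    cut-incr  : (i : Fin t) → cut (inject₁ i) < cut (Fin.suc i)

  InInterval : Fin t → Fin n → Set
  InInterval i r = cut (inject₁ i) ≤ toℕ r × toℕ r < cut (Fin.suc i)

open IntervalDecomp public

-- B (t × t') is an interval minor of A (m × n): there is a block
-- decomposition (rows into t intervals, columns into t' intervals) such
-- that every 1-entry of B sits at a position (i,j) whose block in A is not
-- all zeros (i.e. B is obtained from the contracted matrix by turning some
-- 1-entries into 0-entries).
IsIntervalMinor : {t t' m n : ℕ} → Matrix t t' → Matrix m n → Set
IsIntervalMinor {t} {t'} {m} {n} B A =
  Σ (IntervalDecomp m t) λ R →
  Σ (IntervalDecomp n t') λ C →
  (i : Fin t) (j : Fin t') → T (B i j) →
  ∃ λ (r : Fin m) → ∃ λ (c : Fin n) →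
    InInterval R i r × InInterval C j c × T (A r c)

ones : {m n : ℕ} → Matrix m n → ℕ
ones {m} {n} A =
  sum (map (λ r → sum (map (λ c → if A r c then 1 else 0) (allFin n))) (allFin m))

{-# OPTIONS --safe #-}
-- Halve the columns of a strip of width 2^a, and sort its nonzero rows by
-- whether their ones lie in the left half, the right half, or both.  The rows
-- that meet both halves avoid J_{r,l} inside each half, since the other half
-- supplies one more column interval.  By induction, a strip that avoids
-- J_{r,l+1} has at most 2^l · #(nonzero rows) + r · 4^a ones.  Summing over the
-- strips of width t = 4^k (a = 2k) of a J_k-avoiding matrix, and then doing the
-- same with rows, compares the matrix with its contraction by t × t blocks: with
-- s = 2^(k-1), the number of ones drops by at most a factor s² = t / 4, up to
-- an error linear in the size.  Iterating gives at most 32 k s³ n ones.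
module Submission where

open import Defs
open import Data.Bool using (Bool; true; false; T; _∧_; not; if_then_else_)
open import Data.Bool.Properties using (T-∧)
open import Data.Empty using (⊥-elim)
open import Data.Fin using (Fin; toℕ)
open import Data.Fin.Properties using (toℕ<n; toℕ-fromℕ; toℕ-inject₁)
open import Data.List using (map; allFin; tabulate)
open import Data.List.Properties using (map-tabulate)
open import Data.Nat.ListAction using (sum)
open import Data.Nat using (ℕ; zero; suc; _≤_; _<_; _*_; _^_; _+_; z≤n; s≤s; NonZero)
open import Data.Nat.DivMod using (_/_; _%_; m≡m%n+[m/n]*n; m%n<n; m/n*n≤m)
open import Data.Nat.Induction using (<-rec)
open import Data.Nat.Properties
open import Data.Nat.Solver using (module +-*-Solver)
open import Data.Product using (∃; ∃₂; _×_; _,_; proj₁; proj₂)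
open import Data.Unit using (tt)
open import Function using (_∘_; flip; _$_)
open import Function.Bundles using (Equivalence)
open import Relation.Nullary using (¬_; yes; no)
open import Relation.Binary.PropositionalEquality using (_≡_; refl; sym; trans; cong; cong₂; subst; subst₂)

open +-*-Solver using (solve; _:=_; _:+_; _:*_; con)

-- Finite sums

Sum : ℕ → (ℕ → ℕ) → ℕ
Sum zero    f = 0
Sum (suc n) f = f 0 + Sum n (f ∘ suc)

Sum-cong : ∀ n {f g : ℕ → ℕ} → (∀ i → f i ≡ g i) → Sum n f ≡ Sum n g
Sum-cong zero    e = refl
Sum-cong (suc n) e = cong₂ _+_ (e 0) (Sum-cong n (e ∘ suc))

Sum-mono : ∀ n {f g : ℕ → ℕ} → (∀ i → f i ≤ g i) → Sum n f ≤ Sum n g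
Sum-mono zero    e = z≤n
Sum-mono (suc n) e = +-mono-≤ (e 0) (Sum-mono n (e ∘ suc))

Sum-monoˡ : ∀ {m n} (f : ℕ → ℕ) → m ≤ n → Sum m f ≤ Sum n f
Sum-monoˡ f z≤n     = z≤n
Sum-monoˡ f (s≤s h) = +-monoʳ-≤ (f 0) (Sum-monoˡ (f ∘ suc) h)

Sum-const : ∀ n c → Sum n (λ _ → c) ≡ n * c
Sum-const zero    c = refl
Sum-const (suc n) c = cong (c +_) (Sum-const n c)

Sum-zero : ∀ n → Sum n (λ _ → 0) ≡ 0
Sum-zero n = trans (Sum-const n 0) (*-zeroʳ n)

Sum-distrib-+ : ∀ n (f g : ℕ → ℕ) → Sum n (λ i → f i + g i) ≡ Sum n f + Sum n g
Sum-distrib-+ zero    f g = refl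
Sum-distrib-+ (suc n) f g rewrite Sum-distrib-+ n (f ∘ suc) (g ∘ suc) =
  solve 4 (λ a b c d → (a :+ b) :+ (c :+ d) := (a :+ c) :+ (b :+ d)) refl
    (f 0) (g 0) (Sum n (f ∘ suc)) (Sum n (g ∘ suc))

*-distribˡ-Sum : ∀ n c (f : ℕ → ℕ) → Sum n (λ i → c * f i) ≡ c * Sum n f
*-distribˡ-Sum zero    c f = sym (*-zeroʳ c)
*-distribˡ-Sum (suc n) c f rewrite *-distribˡ-Sum n c (f ∘ suc) =
  sym (*-distribˡ-+ c (f 0) (Sum n (f ∘ suc)))

Sum-swap : ∀ m n (f : ℕ → ℕ → ℕ) →
  Sum m (λ i → Sum n (f i)) ≡ Sum n (λ j → Sum m (λ i → f i j))
Sum-swap zero    n f = sym (Sum-zero n)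
Sum-swap (suc m) n f rewrite Sum-swap m n (f ∘ suc) =
  sym (Sum-distrib-+ n (f 0) (λ j → Sum m (λ i → f (suc i) j)))

Sum-split : ∀ m n (f : ℕ → ℕ) → Sum (m + n) f ≡ Sum m f + Sum n (λ j → f (m + j))
Sum-split zero    n f = refl
Sum-split (suc m) n f rewrite Sum-split m n (f ∘ suc) =
  sym (+-assoc (f 0) (Sum m (f ∘ suc)) _)

Sum-blocks : ∀ m t (f : ℕ → ℕ) → Sum (m * t) f ≡ Sum m (λ j → Sum t (λ c → f (j * t + c)))
Sum-blocks zero    t f = refl
Sum-blocks (suc m) t f = trans (Sum-split t (m * t) f)
  (cong (Sum t f +_) (trans (Sum-blocks m t (λ j → f (t + j)))
    (Sum-cong m λ j → Sum-cong t λ c → cong f (sym (+-assoc t (j * t) c)))))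

bit : Bool → ℕ
bit b = if b then 1 else 0

bit≤1 : ∀ b → bit b ≤ 1
bit≤1 true  = ≤-refl
bit≤1 false = z≤n

positive : ℕ → Bool
positive zero    = false
positive (suc _) = true

Sum-positive : ∀ n (f : ℕ → Bool) → T (positive (Sum n (bit ∘ f))) → ∃ λ i → i < n × T (f i)
Sum-positive (suc n) f p with f 0 in eq
... | true  = 0 , s≤s z≤n , subst T (sym eq) tt
... | false with Sum-positive n (f ∘ suc) p
...   | i , i<n , h = suc i , s≤s i<n , h

-- Matrices indexed by ℕ × ℕ and their interval minors

ℕMatrix : Set
ℕMatrix = ℕ → ℕ → Bool

-- A record rather than a Σ-type, so that M can be inferred although T is not injective.
record Hit (M : ℕMatrix) (p q u v : ℕ) : Set where
  constructor hit
  field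
    row col : ℕ
    row-in  : p ≤ row × row < q
    col-in  : u ≤ col × col < v
    one     : T (M row col)

-- J_{r,l} is an interval minor; ρ and σ list the cut points.
HasMinor : ℕMatrix → (r l : ℕ) → Set
HasMinor M r l = ∃₂ λ (ρ σ : ℕ → ℕ) →
  ∀ i j → i < r → j < l → Hit M (ρ i) (ρ (suc i)) (σ j) (σ (suc j))

HasMinor-flip : ∀ {M r l} → HasMinor (flip M) r l → HasMinor M l r
HasMinor-flip (ρ , σ , h) = σ , ρ , λ i j i<l j<r →
  let hit c r pc pr t = h j i j<r i<l in hit r c pr pc t

-- A chain starts exactly at `x` but may stop short of `y`. The slack makes enlarging `y` free,
-- whereas extending to the left means widening the first link.
data Chain (P : ℕ → ℕ → Set) : ℕ → ℕ → ℕ → Set where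
  end  : ∀ {x y} → x ≤ y → Chain P 0 x y
  step : ∀ {l x z y} → P x z → Chain P l z y → Chain P (suc l) x y

Chain-map : ∀ {P Q l x y} → (∀ {u v} → P u v → Q u v) → Chain P l x y → Chain Q l x y
Chain-map f (end h)    = end h
Chain-map f (step p c) = step (f p) (Chain-map f c)

Chain-extendʳ : ∀ {P l x y y′} → y ≤ y′ → Chain P l x y → Chain P l x y′
Chain-extendʳ h (end k)    = end (≤-trans k h)
Chain-extendʳ h (step p c) = step p (Chain-extendʳ h c)

Chain-cuts : ∀ {P l x y} → Chain P l x y →
  ∃ λ (σ : ℕ → ℕ) → σ 0 ≡ x × (∀ j → j < l → P (σ j) (σ (suc j)))
Chain-cuts {x = x} (end _) = (λ _ → x) , refl , λ _ ()
Chain-cuts {P} {x = x} (step p c) with Chain-cuts c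
... | σ , e , h = σ′ , refl , h′
  where
  σ′ : ℕ → ℕ
  σ′ zero    = x
  σ′ (suc j) = σ j
  h′ : ∀ j → j < _ → P (σ′ j) (σ′ (suc j))
  h′ zero    _       = subst (P x) (sym e) p
  h′ (suc j) (s≤s k) = h j k

HitAll : ℕMatrix → (r : ℕ) → (ℕ → ℕ) → ℕ → ℕ → Set
HitAll M r ρ u v = ∀ i → i < r → Hit M (ρ i) (ρ (suc i)) u v

HitAll-extend : ∀ {M r ρ u u′ v v′} → u′ ≤ u → v ≤ v′ → HitAll M r ρ u v → HitAll M r ρ u′ v′
HitAll-extend hu hv h i i<r =
  let hit r c pr (a , b) t = h i i<r in hit r c pr (≤-trans hu a , ≤-trans b hv) t

Chain-append : ∀ {M r ρ l x y z} → Chain (HitAll M r ρ) l x y → HitAll M r ρ y z → y ≤ z →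
  Chain (HitAll M r ρ) (suc l) x z
-- Any gap between the last cut and `y` is absorbed into the appended interval.
Chain-append (end h)    q k = step (HitAll-extend h ≤-refl q) (end ≤-refl)
Chain-append (step p c) q k = step p (Chain-append c q k)

StripMinor : ℕMatrix → (r l x y : ℕ) → Set
StripMinor M r l x y = ∃ λ ρ → Chain (HitAll M r ρ) l x y

StripMinor⇒HasMinor : ∀ {M r l x y} → StripMinor M r l x y → HasMinor M r l
StripMinor⇒HasMinor (ρ , c) with Chain-cuts c
... | σ , _ , h = ρ , σ , λ i j i<r j<l → h j j<l i i<r

-- Rows are blanked rather than deleted, so row cuts found in the masked matrix serve unchanged in
-- `M`.
mask : (ℕ → Bool) → ℕMatrix → ℕMatrix
mask μ M i c = μ i ∧ M i c

unmask : ∀ μ M i c → T (mask μ M i c) → T (μ i) × T (M i c)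
unmask μ M i c = Equivalence.to T-∧

HitAll-unmask : ∀ {μ M r ρ u v} → HitAll (mask μ M) r ρ u v → HitAll M r ρ u v
HitAll-unmask {μ} {M} h i i<r =
  let hit r c pr pc t = h i i<r in hit r c pr pc (proj₂ (unmask μ M r c t))

StripMinor-unmask : ∀ {μ M r l x y} → StripMinor (mask μ M) r l x y → StripMinor M r l x y
StripMinor-unmask {μ} {M} (ρ , c) = ρ , Chain-map (HitAll-unmask {μ} {M}) c

-- The number of ones of a strip

rowSum : ℕMatrix → (x w i : ℕ) → ℕ
rowSum M x w i = Sum w (λ j → bit (M i (x + j)))

rowHit : ℕMatrix → (x w i : ℕ) → Bool
rowHit M x w i = positive (rowSum M x w i)

rowSum-mask : ∀ μ M x w i → rowSum (mask μ M) x w i ≡ (if μ i then rowSum M x w i else 0)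
rowSum-mask μ M x w i with μ i
... | true  = refl
... | false = Sum-zero w

rowSum-split : ∀ M x w i → rowSum M x (w + w) i ≡ rowSum M x w i + rowSum M (x + w) w i
rowSum-split M x w i = trans (Sum-split w w (λ j → bit (M i (x + j))))
  (cong (rowSum M x w i +_) (Sum-cong w λ j → cong (bit ∘ M i) (sym (+-assoc x w j))))

rowSum-bound : ∀ M x w i → rowSum M x w i ≤ w * bit (rowHit M x w i)
rowSum-bound M x w i with rowSum M x w i in eq
... | zero  = z≤n
... | suc k = subst₂ _≤_ eq (Sum-const w 1) (Sum-mono w λ j → bit≤1 (M i (x + j)))

rowHit-hit : ∀ M x w i → T (rowHit M x w i) → ∃ λ c → (x ≤ c × c < x + w) × T (M i c)
rowHit-hit M x w i h =
  let (j , j<w , t) = Sum-positive w (λ j → M i (x + j)) h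
  in x + j , (m≤m+n x j , +-monoʳ-< x j<w) , t

-- The first `r` indices satisfying `Q` become the left ends of the intervals, and the last interval
-- closes right after the last of them.
cutsThrough : ∀ n (Q : ℕ → Bool) r → r ≤ Sum n (bit ∘ Q) →
  ∃ λ (ρ : ℕ → ℕ) → ∀ i → i < r → ∃ λ m → (ρ i ≤ m × m < ρ (suc i)) × T (Q m)
cutsThrough n       Q zero    _ = (λ i → i) , λ _ ()
cutsThrough (suc n) Q (suc r) h with Q 0 in eq
... | false with cutsThrough n (Q ∘ suc) (suc r) h
...   | ρ , f = suc ∘ ρ , λ i i<r →
        let (m , (a , b) , t) = f i i<r in suc m , (s≤s a , s≤s b) , t
cutsThrough (suc n) Q (suc r) (s≤s h) | true with cutsThrough n (Q ∘ suc) r h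
... | ρ , f = ρ′ , f′
  where
  ρ′ : ℕ → ℕ
  ρ′ zero    = 0
  ρ′ (suc i) = suc (ρ i)
  f′ : ∀ i → i < suc r → ∃ λ m → (ρ′ i ≤ m × m < ρ′ (suc i)) × T (Q m)
  f′ zero    _       = 0 , (z≤n , s≤s z≤n) , subst T (sym eq) tt
  f′ (suc i) (s≤s k) = let (m , (a , b) , t) = f i k in suc m , (s≤s a , s≤s b) , t

-- The whole strip serves as the single column interval, and each of `r` nonzero rows gets a row
-- interval of its own.
rows⇒StripMinor : ∀ M n x w r → r ≤ Sum n (bit ∘ rowHit M x w) → StripMinor M r 1 x (x + w)
rows⇒StripMinor M n x w r h with cutsThrough n (rowHit M x w) r h
... | ρ , f = ρ , step hits (end ≤-refl)
  where
  hits : HitAll M r ρ x (x + w)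
  hits i i<r =
    let (m , pm , t) = f i i<r
        (c , pc , t′) = rowHit-hit M x w m t
    in hit m c pm pc t′

-- Halving a strip

leftOnly rightOnly both : ℕ → ℕ → Bool
leftOnly  L R = positive L ∧ not (positive R)
rightOnly L R = not (positive L) ∧ positive R
both      L R = positive L ∧ positive R

when : Bool → ℕ → ℕ
when b n = if b then n else 0

-- The four summands are the row sums of the masked halves as computed by `rowSum-mask`; which of
-- them survive depends only on whether `L` and `R` vanish.
split-ones : ∀ L R → L + R ≡
  when (leftOnly L R) L + (when (rightOnly L R) R + (when (both L R) L + when (both L R) R))
split-ones zero    zero    = refl
split-ones zero    (suc R) = sym (+-identityʳ (suc R))
split-ones (suc L) zero    = refl
split-ones (suc L) (suc R) = refl

-- A row meeting both halves is counted in each of them, but with half the weight.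
split-hits : ∀ p L R →
  2 * p * bit (positive (when (leftOnly L R) L)) + (2 * p * bit (positive (when (rightOnly L R) R))
    + (p * bit (positive (when (both L R) L)) + p * bit (positive (when (both L R) R))))
  ≡ 2 * p * bit (positive (L + R))
split-hits p zero    zero    = solve 1 (λ p → con 2 :* p :* con 0 :+ (con 2 :* p :* con 0
  :+ (p :* con 0 :+ p :* con 0)) := con 2 :* p :* con 0) refl p
split-hits p zero    (suc R) = solve 1 (λ p → con 2 :* p :* con 0 :+ (con 2 :* p :* con 1
  :+ (p :* con 0 :+ p :* con 0)) := con 2 :* p :* con 1) refl p
split-hits p (suc L) zero    = solve 1 (λ p → con 2 :* p :* con 1 :+ (con 2 :* p :* con 0
  :+ (p :* con 0 :+ p :* con 0)) := con 2 :* p :* con 1) refl p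
split-hits p (suc L) (suc R) = solve 1 (λ p → con 2 :* p :* con 0 :+ (con 2 :* p :* con 0
  :+ (p :* con 1 :+ p :* con 1)) := con 2 :* p :* con 1) refl p

-- `h` is the additive error. Quantifying over `M` and `x` lets the induction pass to masked copies
-- of either half.
StripBound : (r l w h : ℕ) → Set
StripBound r l w h = ∀ M n x → ¬ StripMinor M r (suc l) x (x + w) →
  Sum n (rowSum M x w) ≤ 2 ^ l * Sum n (bit ∘ rowHit M x w) + h

-- Avoiding `J_{r,1}` leaves fewer than `r` nonzero rows, each with at most `w` ones.
strip-bound-rows : ∀ r w → StripBound r 0 w (w * r)
strip-bound-rows r w M n x avoid = begin
  Sum n (rowSum M x w)                       ≤⟨ Sum-mono n (rowSum-bound M x w) ⟩
  Sum n (λ i → w * bit (rowHit M x w i))     ≡⟨ *-distribˡ-Sum n w _ ⟩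
  w * Sum n (bit ∘ rowHit M x w)             ≤⟨ *-monoʳ-≤ w (<⇒≤ (≰⇒> λ h → avoid (rows⇒StripMinor M n x w r h))) ⟩
  w * r                                      ≤⟨ m≤n+m (w * r) _ ⟩
  1 * Sum n (bit ∘ rowHit M x w) + w * r     ∎
  where open ≤-Reasoning

strip-bound-column : ∀ r l → StripBound r l 1 0
strip-bound-column r l M n x _ = begin
  Sum n (rowSum M x 1)                       ≤⟨ Sum-mono n (rowSum-bound M x 1) ⟩
  Sum n (λ i → 1 * bit (rowHit M x 1 i))     ≡⟨ *-distribˡ-Sum n 1 _ ⟩
  1 * Sum n (bit ∘ rowHit M x 1)             ≤⟨ *-monoˡ-≤ _ (m^n>0 2 l) ⟩
  2 ^ l * Sum n (bit ∘ rowHit M x 1)         ≤⟨ m≤m+n _ 0 ⟩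
  2 ^ l * Sum n (bit ∘ rowHit M x 1) + 0     ∎
  where open ≤-Reasoning

-- Rows meeting one half only are charged there at the rate `2 ^ suc l`. Rows meeting both are
-- charged in each half, where they avoid `J_{r,l+1}`, so at half the rate: the total is again
-- `2 ^ suc l` per nonzero row. The four bounds used contribute `4 * h`.
strip-bound-halve : ∀ r l w h → StripBound r (suc l) w h → StripBound r l w h →
  StripBound r (suc l) (w + w) (4 * h)
strip-bound-halve r l w h bound bound′ M n x avoid = begin
  Sum n (rowSum M x (w + w))
    ≡⟨ Sum-cong n ones-row ⟩
  Sum n (λ i → oL i + (oR i + (oB i + oB′ i)))
    ≡⟨ distrib₄ oL oR oB oB′ ⟩
  Sum n oL + (Sum n oR + (Sum n oB + Sum n oB′))
    ≤⟨ +-mono-≤ (bound ML n x avoidL) (+-mono-≤ (bound MR n y avoidR)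
        (+-mono-≤ (bound′ MB n x avoidB) (bound′ MB n y avoidB′))) ⟩
  (2 * p * Sum n hL + h) + ((2 * p * Sum n hR + h) + ((p * Sum n hB + h) + (p * Sum n hB′ + h)))
    ≡⟨ solve 5 (λ a b c d h → (a :+ h) :+ ((b :+ h) :+ ((c :+ h) :+ (d :+ h)))
          := (a :+ (b :+ (c :+ d))) :+ con 4 :* h) refl
         (2 * p * Sum n hL) (2 * p * Sum n hR) (p * Sum n hB) (p * Sum n hB′) h ⟩
  (2 * p * Sum n hL + (2 * p * Sum n hR + (p * Sum n hB + p * Sum n hB′))) + 4 * h
    ≡⟨ cong (_+ 4 * h) (sym hits-total) ⟩
  2 * p * Sum n (bit ∘ rowHit M x (w + w)) + 4 * h ∎
  where
  open ≤-Reasoning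
  p = 2 ^ l
  y = x + w
  L R : ℕ → ℕ
  L = rowSum M x w
  R = rowSum M y w
  μL μR μB : ℕ → Bool
  μL i = leftOnly (L i) (R i)
  μR i = rightOnly (L i) (R i)
  μB i = both (L i) (R i)
  ML MR MB : ℕMatrix
  ML = mask μL M
  MR = mask μR M
  MB = mask μB M
  oL oR oB oB′ hL hR hB hB′ : ℕ → ℕ
  oL  = rowSum ML x w
  oR  = rowSum MR y w
  oB  = rowSum MB x w
  oB′ = rowSum MB y w
  hL  = bit ∘ rowHit ML x w
  hR  = bit ∘ rowHit MR y w
  hB  = bit ∘ rowHit MB x w
  hB′ = bit ∘ rowHit MB y w

  distrib₄ : ∀ (f g f′ g′ : ℕ → ℕ) → Sum n (λ i → f i + (g i + (f′ i + g′ i)))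
    ≡ Sum n f + (Sum n g + (Sum n f′ + Sum n g′))
  distrib₄ f g f′ g′ = trans (Sum-distrib-+ n f _) (cong (Sum n f +_)
    (trans (Sum-distrib-+ n g _) (cong (Sum n g +_) (Sum-distrib-+ n f′ g′))))

  ones-row : ∀ i → rowSum M x (w + w) i ≡ oL i + (oR i + (oB i + oB′ i))
  ones-row i rewrite rowSum-mask μL M x w i | rowSum-mask μR M y w i
    | rowSum-mask μB M x w i | rowSum-mask μB M y w i
    = trans (rowSum-split M x w i) (split-ones (L i) (R i))

  hits-row : ∀ i → 2 * p * bit (rowHit M x (w + w) i)
    ≡ 2 * p * hL i + (2 * p * hR i + (p * hB i + p * hB′ i))
  hits-row i rewrite rowSum-mask μL M x w i | rowSum-mask μR M y w i
    | rowSum-mask μB M x w i | rowSum-mask μB M y w i | rowSum-split M x w i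
    = sym (split-hits p (L i) (R i))

  hits-total : 2 * p * Sum n (bit ∘ rowHit M x (w + w))
    ≡ 2 * p * Sum n hL + (2 * p * Sum n hR + (p * Sum n hB + p * Sum n hB′))
  hits-total = trans (sym (*-distribˡ-Sum n (2 * p) _)) (trans (Sum-cong n hits-row)
    (trans (distrib₄ (λ i → 2 * p * hL i) (λ i → 2 * p * hR i) (λ i → p * hB i) (λ i → p * hB′ i))
      (cong₂ _+_ (*-distribˡ-Sum n (2 * p) hL) (cong₂ _+_ (*-distribˡ-Sum n (2 * p) hR)
        (cong₂ _+_ (*-distribˡ-Sum n p hB) (*-distribˡ-Sum n p hB′))))))

  y+w : y + w ≡ x + (w + w)
  y+w = +-assoc x w w

  x≤y : x ≤ y
  x≤y = m≤m+n x w

  y≤z : y ≤ x + (w + w)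
  y≤z = subst (y ≤_) y+w (m≤m+n y w)

  -- A hit in `MB` lies in just one place of its row, but `μB` guarantees that this row meets both
  -- halves. Hence each whole half is available as a further column interval for the same `ρ`.
  meets-halves : ∀ {ρ u v} → HitAll MB r ρ u v →
    HitAll M r ρ x y × HitAll M r ρ y (x + (w + w))
  meets-halves {ρ} f = (λ i i<r → left i (f i i<r)) , (λ i i<r → right i (f i i<r))
    where
    left : ∀ i {u v} → Hit MB (ρ i) (ρ (suc i)) u v → Hit M (ρ i) (ρ (suc i)) x y
    left i (hit m c pm pc t) =
      let (c′ , pc′ , t′) = rowHit-hit M x w m
            (proj₁ (Equivalence.to T-∧ (proj₁ (unmask μB M m c t))))
      in hit m c′ pm pc′ t′
    right : ∀ i {u v} → Hit MB (ρ i) (ρ (suc i)) u v → Hit M (ρ i) (ρ (suc i)) y (x + (w + w))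
    right i (hit m c pm pc t) =
      let (c′ , (a , b) , t′) = rowHit-hit M y w m
            (proj₂ (Equivalence.to T-∧ (proj₁ (unmask μB M m c t))))
      in hit m c′ pm (a , subst (c′ <_) y+w b) t′

  avoidL : ¬ StripMinor ML r (suc (suc l)) x (x + w)
  avoidL m with StripMinor-unmask {μL} {M} m
  ... | ρ , c = avoid (ρ , Chain-extendʳ y≤z c)

  avoidR : ¬ StripMinor MR r (suc (suc l)) y (y + w)
  avoidR m with StripMinor-unmask {μR} {M} m
  -- The chain must start at `x`, so its first interval is stretched leftwards from `y`.
  ... | ρ , step q c = avoid (ρ , Chain-extendʳ (≤-reflexive y+w)
                                   (step (HitAll-extend x≤y ≤-refl q) c))

  -- The `suc l` column intervals in the left half, followed by the right half as one more, would
  -- give `suc (suc l)` of them; `avoidB′` puts the left half in front instead.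
  avoidB : ¬ StripMinor MB r (suc l) x (x + w)
  avoidB m@(ρ , step q _) = avoid (ρ ,
    Chain-append (proj₂ (StripMinor-unmask {μB} {M} m)) (proj₂ (meets-halves q)) y≤z)

  avoidB′ : ¬ StripMinor MB r (suc l) y (y + w)
  avoidB′ m@(ρ , step q _) = avoid (ρ , step (proj₁ (meets-halves q))
    (Chain-extendʳ (≤-reflexive y+w) (proj₂ (StripMinor-unmask {μB} {M} m))))

StripBound-weaken : ∀ {r l w h h′} → h ≤ h′ → StripBound r l w h → StripBound r l w h′
StripBound-weaken k b M n x avoid = ≤-trans (b M n x avoid) (+-monoʳ-≤ _ k)

-- Halving lowers `a`, and for the rows meeting both halves `l` as well. The error quadruples with
-- each doubling of the width, hence `4 ^ a`.
strip-bound : ∀ r l a → StripBound r l (2 ^ a) (4 ^ a * r)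
strip-bound r zero    a       = StripBound-weaken {r} {0} {2 ^ a}
  (*-monoˡ-≤ r (^-monoˡ-≤ a (s≤s (s≤s (z≤n {2}))))) (strip-bound-rows r (2 ^ a))
strip-bound r (suc l) zero    = StripBound-weaken {r} {suc l} {1} z≤n (strip-bound-column r (suc l))
strip-bound r (suc l) (suc a)
  rewrite +-identityʳ (2 ^ a) | *-assoc 4 (4 ^ a) r =
  strip-bound-halve r l (2 ^ a) (4 ^ a * r) (strip-bound r (suc l) a) (strip-bound r l a)

-- Contracting blocks

Ones : ℕMatrix → (m n : ℕ) → ℕ
Ones M m n = Sum m (λ i → Sum n (λ j → bit (M i j)))

Ones-flip : ∀ M m n → Ones M m n ≡ Ones (flip M) n m
Ones-flip M m n = Sum-swap m n (λ i j → bit (M i j))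

Ones-monoˡ : ∀ M {m m′} n → m ≤ m′ → Ones M m n ≤ Ones M m′ n
Ones-monoˡ M n = Sum-monoˡ _

Ones-monoʳ : ∀ M m {n n′} → n ≤ n′ → Ones M m n ≤ Ones M m n′
Ones-monoʳ M m h = Sum-mono m λ i → Sum-monoˡ _ h

Ones-trivial : ∀ M m n → Ones M m n ≤ m * n
Ones-trivial M m n = begin
  Ones M m n                       ≤⟨ Sum-mono m (λ i → Sum-mono n (λ j → bit≤1 (M i j))) ⟩
  Sum m (λ _ → Sum n (λ _ → 1))    ≡⟨ Sum-const m _ ⟩
  m * Sum n (λ _ → 1)              ≡⟨ cong (m *_) (trans (Sum-const n 1) (*-identityʳ n)) ⟩
  m * n                            ∎
  where open ≤-Reasoning

-- Only columns are grouped; rows are treated later by transposing.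
contract : ℕ → ℕMatrix → ℕMatrix
contract t M i j = rowHit M (j * t) t i

-- Column cuts scale by `t`: a one of the contraction in column `c` yields a one of `M` in the
-- columns from `c * t` up to, but excluding, `c * t + t`.
contract-HasMinor : ∀ {M r l} t → HasMinor (contract t M) r l → HasMinor M r l
contract-HasMinor {M} t (ρ , σ , h) = ρ , (λ j → σ j * t) , λ i j i<r j<l →
  let hit m c pm (a , b) one = h i j i<r j<l
      (c′ , (a′ , b′) , one′) = rowHit-hit M (c * t) t m one
  in hit m c′ pm
       (≤-trans (*-monoˡ-≤ t a) a′ ,
        <-≤-trans b′ (≤-trans (≤-reflexive (+-comm (c * t) t)) (*-monoˡ-≤ t b))) one′

-- The nonzero rows of the `j`-th strip are the ones in column `j` of the contraction, so
-- `strip-bound` can be summed over the `m` strips.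
contract-bound : ∀ r l a M n m → ¬ HasMinor M r (suc l) →
  Ones M n (m * 2 ^ a) ≤ 2 ^ l * Ones (contract (2 ^ a) M) n m + m * (4 ^ a * r)
contract-bound r l a M n m avoid = begin
  Ones M n (m * t)
    ≡⟨ Sum-cong n (λ i → Sum-blocks m t (λ j → bit (M i j))) ⟩
  Sum n (λ i → Sum m (λ j → rowSum M (j * t) t i))
    ≡⟨ Sum-swap n m _ ⟩
  Sum m (λ j → Sum n (rowSum M (j * t) t))
    ≤⟨ Sum-mono m (λ j → strip-bound r l a M n (j * t)
         (λ s → avoid (StripMinor⇒HasMinor s))) ⟩
  Sum m (λ j → 2 ^ l * Sum n (λ i → bit (M′ i j)) + 4 ^ a * r)
    ≡⟨ Sum-distrib-+ m (λ j → 2 ^ l * Sum n (λ i → bit (M′ i j))) (λ _ → 4 ^ a * r) ⟩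
  Sum m (λ j → 2 ^ l * Sum n (λ i → bit (M′ i j))) + Sum m (λ _ → 4 ^ a * r)
    ≡⟨ cong₂ _+_ (*-distribˡ-Sum m (2 ^ l) _) (Sum-const m _) ⟩
  2 ^ l * Sum m (λ j → Sum n (λ i → bit (M′ i j))) + m * (4 ^ a * r)
    ≡⟨ cong (λ z → 2 ^ l * z + m * (4 ^ a * r)) (Sum-swap m n (λ j i → bit (M′ i j))) ⟩
  2 ^ l * Ones M′ n m + m * (4 ^ a * r) ∎
  where
  open ≤-Reasoning
  t = 2 ^ a
  M′ = contract t M

-- The recursion

-- This is the transpose of the contraction by `t × t` blocks. It is left transposed because `J_k`
-- is symmetric.
contract² : ℕ → ℕMatrix → ℕMatrix
contract² t M = contract t (flip (contract t M))

contract²-avoids : ∀ {M k} t → ¬ HasMinor M k k → ¬ HasMinor (contract² t M) k k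
contract²-avoids {M} t avoid h = avoid (contract-HasMinor {M} t
  (HasMinor-flip {contract t M} (contract-HasMinor {flip (contract t M)} t h)))

-- Since `M` is defined on all of ℕ × ℕ, each side can be rounded up to `m * t` just before it is
-- contracted. The error of the second contraction is multiplied by the factor `s` of the first.
contract²-bound : ∀ r a M n m → ¬ HasMinor M (suc r) (suc r) → n ≤ m * 2 ^ a →
  let s = 2 ^ r ; e = m * (4 ^ a * suc r) in
  Ones M n n ≤ s * (s * Ones (contract² (2 ^ a) M) m m + e) + e
contract²-bound r a M n m avoid n≤mt = begin
  Ones M n n                          ≤⟨ Ones-monoʳ M n n≤mt ⟩
  Ones M n (m * t)                    ≤⟨ contract-bound (suc r) r a M n m avoid ⟩
  s * Ones M′ n m + e                 ≤⟨ +-monoˡ-≤ e (*-monoʳ-≤ s (Ones-monoˡ M′ m n≤mt)) ⟩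
  s * Ones M′ (m * t) m + e           ≡⟨ cong (λ z → s * z + e) (Ones-flip M′ (m * t) m) ⟩
  s * Ones (flip M′) m (m * t) + e    ≤⟨ +-monoˡ-≤ e (*-monoʳ-≤ s (contract-bound (suc r) r a (flip M′) m m
                                           (λ h → avoid (contract-HasMinor {M} t (HasMinor-flip {M′} h))))) ⟩
  s * (s * Ones (contract² t M) m m + e) + e ∎
  where
  open ≤-Reasoning
  t = 2 ^ a
  s = 2 ^ r
  e = m * (4 ^ a * suc r)
  M′ = contract t M

2^2k : ∀ r → 2 ^ (2 * suc r) ≡ 4 * (2 ^ r * 2 ^ r)
2^2k r = trans (cong (2 ^_) (solve 1 (λ r → con 2 :* (con 1 :+ r) := con 2 :+ (r :+ r)) refl r))
  (trans (^-distribˡ-+-* 2 2 (r + r)) (cong (4 *_) (^-distribˡ-+-* 2 r r)))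

4^a≡2^a*2^a : ∀ a → 4 ^ a ≡ 2 ^ a * 2 ^ a
4^a≡2^a*2^a a = trans (^-*-assoc 2 2 a)
  (trans (cong (2 ^_) (cong (a +_) (+-identityʳ a))) (^-distribˡ-+-* 2 a a))

-- `C` is chosen so that, after multiplication by 4, the main term `t * (C * m)` and the error term
-- `8 * (s * e)` both equal `m * t * C`. Rounding loses another factor 2 in `m * t ≤ n + n`; the 4
-- in `t ≡ 4 * (s * s)` pays for both doublings.
recursion-arith : ∀ k s t m n X Y → t ≡ 4 * (s * s) → 1 ≤ s → m * t ≤ n + n →
  let C = 8 * k * s * t ; e = m * (t * t * k) in
  X ≤ s * (s * Y + e) + e → Y ≤ C * m → X ≤ C * n
recursion-arith k s t m n X Y t≡ 1≤s mt≤2n X≤ Y≤ = *-cancelˡ-≤ 4 $ begin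
  4 * X                                    ≤⟨ *-monoʳ-≤ 4 X≤ ⟩
  4 * (s * (s * Y + e) + e)                ≤⟨ *-monoʳ-≤ 4 (+-mono-≤ (*-monoʳ-≤ s (+-monoˡ-≤ e (*-monoʳ-≤ s Y≤)))
                                                (subst (_≤ s * e) (*-identityˡ e) (*-monoˡ-≤ e 1≤s))) ⟩
  4 * (s * (s * (C * m) + e) + s * e)      ≡⟨ solve 4 (λ s C m e → con 4 :* (s :* (s :* (C :* m) :+ e) :+ s :* e)
                                                := con 4 :* (s :* s) :* (C :* m) :+ con 8 :* (s :* e)) refl s C m e ⟩
  4 * (s * s) * (C * m) + 8 * (s * e)      ≡⟨ cong (λ z → z * (C * m) + 8 * (s * e)) (sym t≡) ⟩
  t * (C * m) + 8 * (s * e)                ≡⟨ solve 4 (λ k s t m → t :* (con 8 :* k :* s :* t :* m)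
                                                :+ con 8 :* (s :* (m :* (t :* t :* k)))
                                                := m :* t :* (con 2 :* (con 8 :* k :* s :* t))) refl k s t m ⟩
  m * t * (2 * C)                          ≤⟨ *-monoˡ-≤ (2 * C) mt≤2n ⟩
  (n + n) * (2 * C)                        ≡⟨ solve 2 (λ n C → (n :+ n) :* (con 2 :* C) := con 4 :* (C :* n)) refl n C ⟩
  4 * (C * n)                              ∎
  where
  open ≤-Reasoning
  C = 8 * k * s * t
  e = m * (t * t * k)

exm-bound : ∀ r n M → ¬ HasMinor M (suc r) (suc r) →
  Ones M n n ≤ 8 * suc r * 2 ^ r * 2 ^ (2 * suc r) * n
exm-bound r = <-rec _ bound
  where
  a = 2 * suc r
  t = 2 ^ a
  s = 2 ^ r
  C = 8 * suc r * s * t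

  1≤s : 1 ≤ s
  1≤s = m^n>0 2 r

  4≤t : 4 ≤ t
  4≤t = subst (4 ≤_) (sym (2^2k r)) (*-monoʳ-≤ 4 (*-mono-≤ 1≤s 1≤s))

  t≤C : t ≤ C
  t≤C = subst (_≤ C) (*-identityˡ t) (*-monoˡ-≤ t (*-mono-≤ {1} {8 * suc r} (s≤s z≤n) 1≤s))

  instance
    t≢0 : NonZero t
    t≢0 = m^n≢0 2 a

  bound : ∀ n → (∀ {m} → m < n → ∀ M → ¬ HasMinor M (suc r) (suc r) → Ones M m m ≤ C * m) →
    ∀ M → ¬ HasMinor M (suc r) (suc r) → Ones M n n ≤ C * n
  bound n ih M avoid with t ≤? n
  -- Below one block the trivial bound `n * n` suffices, as `n < t ≤ C`.
  ... | no t≰n = ≤-trans (Ones-trivial M n n) (*-monoˡ-≤ n (≤-trans (<⇒≤ (≰⇒> t≰n)) t≤C))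
  ... | yes t≤n = recursion-arith (suc r) s t m n _ _ (2^2k r) 1≤s mt≤2n
      (subst (λ z → Ones M n n ≤ s * (s * Ones (contract² t M) m m + m * (z * suc r)) + m * (z * suc r))
        (4^a≡2^a*2^a a) (contract²-bound r a M n m avoid n≤mt))
      (ih m<n (contract² t M) (contract²-avoids {M} t avoid))
    where
    -- One block is added even when `t` divides `n`; since `t ≤ n`, the overshoot still leaves
    -- `m * t ≤ n + n`.
    m = suc (n / t)
    n≤mt : n ≤ m * t
    n≤mt = subst (_≤ m * t) (sym (m≡m%n+[m/n]*n n t)) (+-monoˡ-≤ _ (<⇒≤ (m%n<n n t)))
    mt≤2n : m * t ≤ n + n
    mt≤2n = +-mono-≤ t≤n (m/n*n≤m n t)
    m+m≤n : m + m ≤ n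
    m+m≤n = *-cancelˡ-≤ 2 $ begin
      2 * (m + m)  ≡⟨ solve 1 (λ m → con 2 :* (m :+ m) := m :* con 4) refl m ⟩
      m * 4        ≤⟨ *-monoʳ-≤ m 4≤t ⟩
      m * t        ≤⟨ mt≤2n ⟩
      n + n        ≡⟨ cong (n +_) (sym (+-identityʳ n)) ⟩
      2 * n        ∎
      where open ≤-Reasoning
    m<n : m < n
    m<n = ≤-trans (+-monoˡ-≤ m {1} (s≤s z≤n)) m+m≤n

-- From finite matrices to ℕ × ℕ

extend : ∀ {n} {A : Set} → A → (Fin n → A) → ℕ → A
extend {zero}  d f i       = d
extend {suc n} d f zero    = f Fin.zero
extend {suc n} d f (suc i) = extend d (f ∘ Fin.suc) i

extend-toℕ : ∀ {n} {A : Set} (d : A) (f : Fin n → A) r → extend d f (toℕ r) ≡ f r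
extend-toℕ d f Fin.zero    = refl
extend-toℕ d f (Fin.suc r) = extend-toℕ d (f ∘ Fin.suc) r

extend-true : ∀ {n} (f : Fin n → Bool) i → T (extend false f i) → ∃ λ r → toℕ r ≡ i × T (f r)
extend-true {suc n} f zero    h = Fin.zero , refl , h
extend-true {suc n} f (suc i) h =
  let (r , e , t) = extend-true (f ∘ Fin.suc) i h in Fin.suc r , cong suc e , t

-- Padding with `false` adds no ones, so every hit in the extension comes from an entry of `A`.
extendMatrix : ∀ {m n} → Matrix m n → ℕMatrix
extendMatrix A i j = extend false (λ r → extend false (A r) j) i

extendMatrix-toℕ : ∀ {m n} (A : Matrix m n) r c → extendMatrix A (toℕ r) (toℕ c) ≡ A r c
extendMatrix-toℕ A r c =
  trans (extend-toℕ false (λ r → extend false (A r) (toℕ c)) r) (extend-toℕ false (A r) c)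

extendMatrix-true : ∀ {m n} (A : Matrix m n) i j → T (extendMatrix A i j) →
  ∃₂ λ r c → toℕ r ≡ i × toℕ c ≡ j × T (A r c)
extendMatrix-true A i j h =
  let (r , er , h′) = extend-true (λ r → extend false (A r) j) i h
      (c , ec , h″) = extend-true (A r) j h′
  in r , c , er , ec , h″

sum-allFin : ∀ n (f : Fin n → ℕ) (g : ℕ → ℕ) → (∀ r → f r ≡ g (toℕ r)) →
  sum (map f (allFin n)) ≡ Sum n g
sum-allFin n f g e = trans (cong sum (map-tabulate (λ r → r) f)) (sum-tabulate n f g e)
  where
  sum-tabulate : ∀ n (f : Fin n → ℕ) (g : ℕ → ℕ) → (∀ r → f r ≡ g (toℕ r)) →
    sum (tabulate f) ≡ Sum n g
  sum-tabulate zero    f g e = refl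
  sum-tabulate (suc n) f g e =
    cong₂ _+_ (e Fin.zero) (sum-tabulate n (f ∘ Fin.suc) (g ∘ suc) (e ∘ Fin.suc))

ones-extend : ∀ {m n} (A : Matrix m n) → ones A ≡ Ones (extendMatrix A) m n
ones-extend {m} {n} A = sum-allFin m _ _ λ r → sum-allFin n _ _ λ c →
  cong bit (sym (extendMatrix-toℕ A r c))

-- The outer cuts of a `HasMinor` are arbitrary, while a decomposition starts at 0 and ends at `n`.
-- Replacing them keeps every witness below `n` in its interval.
trim : (k n : ℕ) → (ℕ → ℕ) → ℕ → ℕ
trim k n σ zero    = 0
trim k n σ (suc i) with suc i ≟ k
... | yes _ = n
... | no  _ = σ (suc i)

trim-lower : ∀ {k n σ m} i → i < k → σ i ≤ m → trim k n σ i ≤ m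
trim-lower zero _ _ = z≤n
trim-lower {k} (suc i) i<k h with suc i ≟ k
... | yes e = ⊥-elim (<-irrefl e i<k)
... | no  _ = h

trim-upper : ∀ k {n} σ {m} i → m < n → m < σ (suc i) → m < trim k n σ (suc i)
trim-upper k σ i m<n h with suc i ≟ k
... | yes _ = m<n
... | no  _ = h

trim-last : ∀ k n σ → trim (suc k) n σ (suc k) ≡ n
trim-last k n σ with suc k ≟ suc k
... | yes _ = refl
... | no  h = ⊥-elim (h refl)

-- Strict growth of the cuts comes from the point inhabiting each interval, which lies at or above
-- one cut and below the next.
decomp : ∀ {n k} (σ : ℕ → ℕ) →
  (∀ i → i < suc k → ∃ λ m → (σ i ≤ m × m < σ (suc i)) × m < n) → IntervalDecomp n (suc k)
decomp {n} {k} σ inhabited = record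
  { cut       = trim (suc k) n σ ∘ toℕ
  ; cut-first = refl
  ; cut-last  = trans (cong (trim (suc k) n σ) (toℕ-fromℕ (suc k))) (trim-last k n σ)
  ; cut-incr  = λ i → let (m , (a , b) , m<n) = inhabited (toℕ i) (toℕ<n i) in
      subst (λ z → trim (suc k) n σ z < trim (suc k) n σ (suc (toℕ i))) (sym (toℕ-inject₁ i))
        (≤-<-trans (trim-lower (toℕ i) (toℕ<n i) a) (trim-upper (suc k) σ (toℕ i) m<n b))
  }

decomp-interval : ∀ {n k} σ inhabited (i : Fin (suc k)) (r : Fin n) →
  σ (toℕ i) ≤ toℕ r × toℕ r < σ (suc (toℕ i)) → InInterval (decomp σ inhabited) i r
decomp-interval {n} {k} σ _ i r (a , b) =
  subst (λ z → trim (suc k) n σ z ≤ toℕ r) (sym (toℕ-inject₁ i)) (trim-lower (toℕ i) (toℕ<n i) a) ,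
  trim-upper (suc k) σ (toℕ i) (toℕ<n r) b

HasMinor⇒IsIntervalMinor : ∀ {k m n} (A : Matrix m n) →
  HasMinor (extendMatrix A) (suc k) (suc k) → IsIntervalMinor (J (suc k)) A
HasMinor⇒IsIntervalMinor {k} {m} {n} A (ρ , σ , h) = decomp ρ rows , decomp σ cols , entry
  where
  located : ∀ i j → i < suc k → j < suc k → ∃₂ λ (r : Fin m) (c : Fin n) →
    (ρ i ≤ toℕ r × toℕ r < ρ (suc i)) × (σ j ≤ toℕ c × toℕ c < σ (suc j)) × T (A r c)
  located i j i<k j<k with h i j i<k j<k
  ... | hit p q pr pc t with extendMatrix-true A p q t
  ...   | r , c , refl , refl , t′ = r , c , pr , pc , t′

  -- As the size is positive, there is a column interval 0, and the hit in it shows that the row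
  -- interval is inhabited.
  rows : ∀ i → i < suc k → ∃ λ p → (ρ i ≤ p × p < ρ (suc i)) × p < m
  rows i i<k = let (r , _ , pr , _) = located i 0 i<k (s≤s z≤n) in toℕ r , pr , toℕ<n r

  cols : ∀ j → j < suc k → ∃ λ q → (σ j ≤ q × q < σ (suc j)) × q < n
  cols j j<k = let (_ , c , _ , pc , _) = located 0 j (s≤s z≤n) j<k in toℕ c , pc , toℕ<n c

  entry : ∀ i j → T true → ∃ λ r → ∃ λ c →
    InInterval (decomp ρ rows) i r × InInterval (decomp σ cols) j c × T (A r c)
  entry i j _ =
    let (r , c , pr , pc , t) = located (toℕ i) (toℕ j) (toℕ<n i) (toℕ<n j)
    in r , c , decomp-interval ρ rows i r pr , decomp-interval σ cols j c pc , t

-- The final constants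

3k≤[k+1]^2 : ∀ k → 3 * suc k ≤ (suc k + 1) ^ 2
3k≤[k+1]^2 k = subst (3 * suc k ≤_)
  (solve 1 (λ k → con 3 :* (con 1 :+ k) :+ (k :* k :+ k :+ con 1)
    := (con 1 :+ k :+ con 1) :* ((con 1 :+ k :+ con 1) :* con 1)) refl k)
  (m≤m+n (3 * suc k) (k * k + k + 1))

2^4k : ∀ k → 2 ^ (4 * k) ≡ 2 ^ (2 * k) * 2 ^ (2 * k)
2^4k k = trans (cong (2 ^_) (solve 1 (λ k → con 4 :* k := con 2 :* k :+ con 2 :* k) refl k))
  (^-distribˡ-+-* 2 (2 * k) (2 * k))

theorem1p6 : (k n : ℕ) → 1 ≤ k → (A : Matrix n n) → ¬ IsIntervalMinor (J k) A →
    3 * ones A ≤ 8 * ((k + 1) ^ 2 * 2 ^ (4 * k)) * n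
theorem1p6 k@(suc r) n _ A avoid = begin
  3 * ones A                            ≡⟨ cong (3 *_) (ones-extend A) ⟩
  3 * Ones (extendMatrix A) n n         ≤⟨ *-monoʳ-≤ 3 (exm-bound r n (extendMatrix A)
                                             (avoid ∘ HasMinor⇒IsIntervalMinor A)) ⟩
  3 * (8 * k * s * t * n)               ≡⟨ solve 4 (λ k s t n → con 3 :* (con 8 :* k :* s :* t :* n)
                                             := con 8 :* (con 3 :* k :* (s :* t)) :* n) refl k s t n ⟩
  -- There is room to spare: `3 * k` is absorbed by `(k + 1) ^ 2`, and `s`, which is 2 to the power
  -- k - 1, is enlarged to `t`.
  8 * (3 * k * (s * t)) * n             ≤⟨ *-monoˡ-≤ n (*-monoʳ-≤ 8 (*-mono-≤ (3k≤[k+1]^2 r)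
                                             (*-monoˡ-≤ t (^-monoʳ-≤ 2 r≤2k)))) ⟩
  8 * ((k + 1) ^ 2 * (t * t)) * n       ≡⟨ cong (λ z → 8 * ((k + 1) ^ 2 * z) * n) (sym (2^4k k)) ⟩
  8 * ((k + 1) ^ 2 * 2 ^ (4 * k)) * n   ∎
  where
  open ≤-Reasoning
  s = 2 ^ r
  t = 2 ^ (2 * k)
  r≤2k : r ≤ 2 * k
  r≤2k = ≤-trans (n≤1+n r) (m≤m+n k _)
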